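{- Let $X$ be a finite alphabet with at least two letters and $k\ge2$, and let $\mathcal{B}$ be either the class $\mathcal R$ of regular $\omega$-languages or the class $\mathcal A$ of aperiodic $\omega$-languages over $X$. Then for every $F\in\mathcal{F}_{\mathcal{T}_k}$ we have $\mathcal{B}\mathbf{\Sigma}(F)=\mathcal{B}_k\cap\mathbf{\Sigma}(F)$.
   Context: Regular and aperiodic $\omega$-languages: recognised by deterministic Muller acceptors (resp. with aperiodic automaton, i.e. $f(q,u^n)=q$, $u\neq\varepsilon$, $n>0$ imply $f(q,u)=q$). $\bar k=\{0,\dots,k-1\}$; $\mathcal B_k$ is the set of functions $X^\omega\to\bar k$ all of whose preimages $A^{ -1}(i)$ lie in $\mathcal B$. Trees/forests: a finite nonempty poset whose lower cones are chains is a forest; a tree has a least element. We represent a forest as a finite set $F\subseteq\omega^+$ of nonempty finite strings closed under nonempty prefixes, ordered by the prefix relation (roots are strings of length 1, successors of $\tau$ are the $\tau i\in F$), and a tree as a finite $V\subseteq\omega^*$ closed under prefixes (root $\varepsilon$). $\mathcal T_k$ is the set of trees labeled by $\bar k$; $\mathcal F_{\mathcal T_k}$ the set of forests $(F,c)$ with each label $c(\tau)=(V,v)\in\mathcal T_k$. A 2-base in a set $S$ is a pair $\mathcal L=(\mathcal L_0,\mathcal L_1)$ of families of subsets of $S$ closed under finite unions and intersections and containing $\emptyset,S$, with each set of $\mathcal L_0$ and its complement in $\mathcal L_1$. For a 1-base $\mathcal L'$ in a set $S'$ and a forest (or tree) $W$ labeled in $\bar k$ or $\mathcal T_k$, a $W$-family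 over $\mathcal L'$ is $\{U_\tau\}_{\tau\in W}$ with $U_\tau\in\mathcal L'$, $U_{\tau i}\subseteq U_\tau$, $\bigcup_\tau U_\tau=S'$; write $\tilde U_\tau=U_\tau\setminus\bigcup_{\tau i\in W}U_{\tau i}$. For $(F,c)\in\mathcal F_{\mathcal T_k}$, an $F$-family over $\mathcal L$ consists of an $F$-family $\{U_\tau\}$ over $\mathcal L_0$ and, for each $\tau\in F$ with $c(\tau)=(V,v)$, a $V$-family $\{U_{\tau\sigma}\}_{\sigma\in V}$ over the 1-base $\{\tilde U_\tau\cap B: B\in\mathcal L_1\}$ in $\tilde U_\tau$; it determines $A:S\to\bar k$ if $A(x)=v(\sigma)$ whenever $\tau\in F$, $c(\tau)=(V,v)$, $\sigma\in V$ and $x\in\tilde U_{\tau\sigma}=U_{\tau\sigma}\setminus\bigcup_{\sigma i\in V}U_{\tau\sigma i}$. $\mathcal L(F)$ is the set of $k$-partitions of $S$ determined by some $F$-family over $\mathcal L$. $\mathbf\Sigma=(\mathbf\Sigma^0_1,\mathbf\Sigma^0_2)$ is the 2-base in $X^\omega$ of open sets and countable unions of closed sets (Cantor topology); $\mathbf\Sigma(F)$ is its level. $\mathcal B\mathbf\Sigma$ is the 2-base $(\mathcal B\cap\mathbf\Sigma^0_1,\mathcal B\cap\mathbf\Sigma^0_2)$ and $\mathcal B\mathbf\Sigma(F)$ its level. -}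

module Defs where

open import Data.Nat.Base using (ℕ; zero; suc; _<_; _≤_)
open import Data.Fin.Base using (Fin)
open import Data.Fin.Subset using (Subset)
open import Data.List.Base using (List; []; _∷ʳ_; _++_; foldl; concat; replicate)
open import Data.Product.Base using (Σ-syntax; ∃-syntax; _×_; _,_)
open import Level using (0ℓ; Lift) renaming (suc to lsuc)
open import Relation.Binary.PropositionalEquality.Core using (_≡_; _≢_)
open import Relation.Nullary.Negation.Core using (¬_)
open import Relation.Unary using (Pred; _⊆_; _≐_; _∩_; _∖_; ∁; ⋃)
import Data.Fin.Subset as Subset
import Data.List.Membership.Propositional as List
import Relation.Unary as Unary

-- Subsets of S are predicates in Pred S 0ℓ, identified up to _≐_; each
-- concrete family of sets below is invariant under _≐_.

Family : Set → Set₂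
Family S = Pred (Pred S 0ℓ) (lsuc 0ℓ)

------------------------------------------------------------------------
-- ω-words and the Cantor topology

ω-Word : Set → Set
ω-Word X = ℕ → X

module _ {X : Set} where

  AgreeBelow : ℕ → ω-Word X → ω-Word X → Set
  AgreeBelow n x y = ∀ i → i < n → x i ≡ y i

  IsOpen : Pred (ω-Word X) 0ℓ → Set
  IsOpen U = ∀ x → x Unary.∈ U → ∃[ n ] (∀ y → AgreeBelow n x y → y Unary.∈ U)

  IsClosed : Pred (ω-Word X) 0ℓ → Set
  IsClosed C = IsOpen (∁ C)

-- The level of Σ⁰₁ is raised only so that both classes have type Family.

Σ⁰₁ : (X : Set) → Family (ω-Word X)
Σ⁰₁ X U = Lift (lsuc 0ℓ) (IsOpen U)

Σ⁰₂ : (X : Set) → Family (ω-Word X)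
Σ⁰₂ X U = Σ[ C ∈ (ℕ → Pred (ω-Word X) 0ℓ) ] (∀ n → IsClosed (C n)) × U ≐ ⋃ ℕ C

------------------------------------------------------------------------
-- Regular and aperiodic ω-languages

record Automaton (X : Set) : Set where
  field
    size : ℕ
    step : Fin size → X → Fin size

  State : Set
  State = Fin size

  step* : State → List X → State
  step* = foldl step

  run : State → ω-Word X → ℕ → State
  run q x zero    = q
  run q x (suc n) = step (run q x n) (x n)

  InfinitelyOften : State → ω-Word X → Pred State 0ℓ
  InfinitelyOften q x r = ∀ m → ∃[ n ] m ≤ n × run q x n ≡ r

  IsAperiodic : Set
  IsAperiodic = ∀ q u n → u ≢ [] → 0 < n →
                step* q (concat (replicate n u)) ≡ q → step* q u ≡ q

record MullerAcceptor (X : Set) : Set where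
  field
    automaton : Automaton X
  open Automaton automaton public
  field
    initial   : State
    accepting : List (Subset size)

  Language : Pred (ω-Word X) 0ℓ
  Language x = ∃[ P ] P List.∈ accepting ×
                      InfinitelyOften initial x ≐ (Subset._∈ P)

Regular : (X : Set) → Family (ω-Word X)
Regular X L = Lift (lsuc 0ℓ)
  (Σ[ M ∈ MullerAcceptor X ] L ≐ MullerAcceptor.Language M)

Aperiodic : (X : Set) → Family (ω-Word X)
Aperiodic X L = Lift (lsuc 0ℓ)
  (Σ[ M ∈ MullerAcceptor X ] MullerAcceptor.IsAperiodic M ×
                             L ≐ MullerAcceptor.Language M)

data LanguageClass : Set where
  𝓡 𝓐 : LanguageClass

⟦_⟧ : LanguageClass → (X : Set) → Family (ω-Word X)
⟦ 𝓡 ⟧ = Regular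
⟦ 𝓐 ⟧ = Aperiodic

-- The class 𝓑ₖ of k-partitions all of whose components lie in 𝓑.

Partitions : {S : Set} (k : ℕ) → Family S → Pred (S → Fin k) (lsuc 0ℓ)
Partitions k 𝓑 A = ∀ i → 𝓑 (λ x → A x ≡ i)

------------------------------------------------------------------------
-- Labeled trees and forests of finite strings

-- The list of nodes stands for its set of members: neither order nor
-- multiplicity matters.  Labels of strings that are not nodes are junk
-- values that nothing below depends on.

String : Set
String = List ℕ

record Tree (Label : Set) : Set where
  field
    nodes         : List String
    root          : [] List.∈ nodes
    prefix-closed : ∀ σ ρ → (σ ++ ρ) List.∈ nodes → σ List.∈ nodes
    label         : String → Label

record Forest (Label : Set) : Set where
  field
    nodes         : List String
    nonempty      : ∃[ τ ] τ List.∈ nodes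
    []∉nodes      : ¬ ([] List.∈ nodes)
    prefix-closed : ∀ τ ρ → τ ≢ [] → (τ ++ ρ) List.∈ nodes → τ List.∈ nodes
    label         : String → Label

------------------------------------------------------------------------
-- Levels of the fine hierarchy of k-partitions

module _ {S : Set} where

  -- Ũ_τ, for a family U indexed by the members of W.

  residue : List String → (String → Pred S 0ℓ) → String → Pred S 0ℓ
  residue W U τ = U τ ∖ (λ x → ∃[ i ] (τ ∷ʳ i) List.∈ W × x Unary.∈ U (τ ∷ʳ i))

  -- U is a W-family over the 1-base 𝓛 in the subset S' of S; only the
  -- sets U τ with τ ∈ W are constrained.

  record IsFamily (W : List String) (𝓛 : Family S) (S' : Pred S 0ℓ)
                  (U : String → Pred S 0ℓ) : Set₁ where
    field
      inBase     : ∀ τ → τ List.∈ W → U τ Unary.∈ 𝓛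
      decreasing : ∀ τ i → τ List.∈ W → (τ ∷ʳ i) List.∈ W → U (τ ∷ʳ i) ⊆ U τ
      covers     : (λ x → ∃[ τ ] τ List.∈ W × x Unary.∈ U τ) ≐ S'

  -- The family {T ∩ B : B ∈ 𝓛}.

  restrict : Pred S 0ℓ → Family S → Family S
  restrict T 𝓛 P = Σ[ B ∈ Pred S 0ℓ ] B Unary.∈ 𝓛 × P ≐ (T ∩ B)

-- The components of a 2-base.  The definition of a level does not use the
-- closure properties of 2-bases, so they are not part of the record.

record BasePair (S : Set) : Set₂ where
  constructor basePair
  field
    𝓛₀ 𝓛₁ : Family S

module _ {S : Set} {k : ℕ} (𝓛 : BasePair S) (F : Forest (Tree (Fin k))) where
  open BasePair 𝓛
  private
    module F = Forest F
    module V (τ : String) = Tree (F.label τ)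

  -- inner τ σ is the set U_{τσ}; it takes τ and σ separately because
  -- their concatenation does not determine the pair.

  record ForestFamily : Set₁ where
    field
      outer       : String → Pred S 0ℓ
      inner       : String → String → Pred S 0ℓ
      outerFamily : IsFamily F.nodes 𝓛₀ Unary.U outer
      innerFamily : ∀ τ → τ List.∈ F.nodes →
                    IsFamily (V.nodes τ)
                             (restrict (residue F.nodes outer τ) 𝓛₁)
                             (residue F.nodes outer τ)
                             (inner τ)

    Determines : (S → Fin k) → Set
    Determines A = ∀ τ σ → τ List.∈ F.nodes → σ List.∈ V.nodes τ →
                   ∀ x → x Unary.∈ residue (V.nodes τ) (inner τ) σ →
                   A x ≡ V.label τ σ

  levelOf : Pred (S → Fin k) (lsuc 0ℓ)
  levelOf A = Σ[ U ∈ ForestFamily ] ForestFamily.Determines U A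

𝚺 : (X : Set) → BasePair (ω-Word X)
𝚺 X = basePair (Σ⁰₁ X) (Σ⁰₂ X)

_𝚺[_] : LanguageClass → (X : Set) → BasePair (ω-Word X)
𝓑 𝚺[ X ] = basePair (⟦ 𝓑 ⟧ X ∩ Σ⁰₁ X) (⟦ 𝓑 ⟧ X ∩ Σ⁰₂ X)

{-# OPTIONS --safe #-}

-- Both inclusions turn on the equivalence "the runs of a fixed automaton on x
-- and y have the same limit set": a language is recognised by some acceptor on
-- that automaton iff it is a union of classes.  For ⊆, a product automaton
-- makes every set of the given family a union of classes, hence also A.
--
-- For ⊇, let N be a product of the acceptors of the components of A.  Replace
-- U_τ by the set of words whose run meets a state r such that some cylinder
-- [w|n] ⊆ U_τ ends in r, and U_τσ by the set of words with limit set P such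
-- that, for some w and n, the run of w is in P at time n and every word of
-- [w|n] whose run stays in P from then on lies in U_τσ.  These sets depend only
-- on the limit set.  If x lies in a new residue and has limit set P, then a
-- Baire category argument in {y ∈ [w|n] : the run of y stays in P from n on}
-- yields a y with limit set P in the old residue of the same index, whence
-- A x = A y is the required label.
module Submission where

open import Defs
open import Axiom.ExcludedMiddle using (ExcludedMiddle)
open import Data.Bool.Base using (true; false)
open import Data.Empty using (⊥-elim)
open import Data.Fin.Base using (Fin; combine; remQuot)
open import Data.Fin.Properties using (remQuot-combine; combine-remQuot)
open import Data.Fin.Subset using (Subset)
open import Data.List.Base as List
  using (List; []; _∷_; _∷ʳ_; _++_; length; concat; replicate; filter; allFin;
         cartesianProductWith)
open import Data.List.Extrema.Nat using (max; xs≤max)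
open import Data.List.Membership.Propositional using (_∈_)
open import Data.List.Membership.Propositional.Properties
  using (∈-filter⁺; ∈-filter⁻; ∈-cartesianProductWith⁺; ∈-map⁺; ∈-allFin)
open import Data.List.Properties using (++-identityʳ; ∷ʳ-++; length-++)
import Data.List.Relation.Unary.All as All
open import Data.List.Relation.Unary.Any using (here; there)
open import Data.Nat.Base as ℕ using (ℕ; _+_; _∸_; _⊔_; _≤_; _<_)
open import Data.Nat.Properties
open import Data.Product.Base
  using (Σ-syntax; ∃; ∃-syntax; _×_; _,_; proj₁; proj₂; swap; map; map₁; map₂)
open import Data.Sum.Base using (inj₁; inj₂)
open import Data.Unit.Base using (⊤; tt)
open import Data.Vec.Base using ([]; _∷_; tabulate)
open import Data.Vec.Properties using ([]=⇒lookup; lookup⇒[]=; lookup∘tabulate)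
open import Function.Base using (_∘_; id)
open import Function.Bundles using (_↔_)
open import Level using (0ℓ; suc; lift; lower)
open import Relation.Binary.Core using (Rel; _⇒_)
open import Relation.Binary.PropositionalEquality
open import Relation.Nullary.Decidable
  using (Dec; yes; no; does; map′; decidable-stable; dec-true)
open import Relation.Nullary.Negation using (¬_; contradiction)
open import Relation.Unary using (Pred; _⊆_; _≐_; _∩_; ⋃)
open import Relation.Unary.Properties using (≐-sym; ≐-trans)
import Data.Fin.Subset as Subset

em-lower : ExcludedMiddle (suc 0ℓ) → ExcludedMiddle 0ℓ
em-lower em = map′ lower lift em

-- Words

module _ {X : Set} where

  agree-≤ : ∀ {m n} {x y : ω-Word X} → m ≤ n → AgreeBelow n x y → AgreeBelow m x y
  agree-≤ m≤n x~y i i<m = x~y i (<-≤-trans i<m m≤n)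

  agree-refl : ∀ {n} {x : ω-Word X} → AgreeBelow n x x
  agree-refl _ _ = refl

  agree-trans : ∀ {n} {x y z : ω-Word X} →
                AgreeBelow n x y → AgreeBelow n y z → AgreeBelow n x z
  agree-trans x~y y~z i i<n = trans (x~y i i<n) (y~z i i<n)

  -- Grafts the tail of `x` from position `n` onto the first `l` letters of `w`. When the runs of
  -- `w` at `l` and of `x` at `n` are in the same state, the new run copies that of `x` from there
  -- on.
  splice : ω-Word X → ℕ → ω-Word X → ℕ → ω-Word X
  splice w l x n i with i <? l
  ... | yes _ = w i
  ... | no  _ = x (n + (i ∸ l))

  splice-agree : ∀ w l x n → AgreeBelow l w (splice w l x n)
  splice-agree w l x n i i<l with i <? l
  ... | yes _   = refl
  ... | no  i≮l = contradiction i<l i≮l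

  splice-tail : ∀ w l x n j → splice w l x n (l + j) ≡ x (n + j)
  splice-tail w l x n j with l + j <? l
  ... | yes l+j<l = contradiction l+j<l (m+n≮m l j)
  ... | no  _     = cong (λ i → x (n + i)) (m+n∸m≡n l j)

  -- Relatively dense open sets and Baire category

  DenseOpenIn : Pred (ω-Word X) 0ℓ → Pred (ω-Word X) 0ℓ → Set
  DenseOpenIn K D = ∀ w n → K w → ∃[ w′ ] ∃[ n′ ]
    K w′ × AgreeBelow n w w′ × (∀ y → K y → AgreeBelow n′ w′ y → D y)

  dense-U : ∀ {K D} → (∀ y → D y) → DenseOpenIn K D
  dense-U D w n Kw = w , n , Kw , agree-refl , λ y _ _ → D y

  -- `DenseOpenIn` only asks that `D` contain a relatively open dense subset of `K`, and `n′` may be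
  -- smaller than `n`. So `E` is entered from depth `n ⊔ n₁`, which keeps `w₂` both in the given
  -- cylinder and in the one found for `D`.
  dense-∩ : ∀ {K D E} → DenseOpenIn K D → DenseOpenIn K E → DenseOpenIn K (D ∩ E)
  dense-∩ denseD denseE w n Kw with denseD w n Kw
  ... | w₁ , n₁ , Kw₁ , w~w₁ , D₁ with denseE w₁ (n ⊔ n₁) Kw₁
  ... | w₂ , n₂ , Kw₂ , w₁~w₂ , E₂ =
    w₂ , n₁ ⊔ n₂ , Kw₂ ,
    agree-trans w~w₁ (agree-≤ (m≤m⊔n n n₁) w₁~w₂) ,
    λ y Ky w₂~y →
      D₁ y Ky (agree-trans (agree-≤ (m≤n⊔m n n₁) w₁~w₂) (agree-≤ (m≤m⊔n n₁ n₂) w₂~y)) ,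
      E₂ y Ky (agree-≤ (m≤n⊔m n₁ n₂) w₂~y)

  -- `D` takes a membership proof because the closed sets avoided later are extracted from `inBase`,
  -- which needs one.
  dense-⋂ : ∀ {K} {I : Set} (is : List I) (D : ∀ i → i ∈ is → Pred (ω-Word X) 0ℓ) →
            (∀ i i∈is → DenseOpenIn K (D i i∈is)) →
            DenseOpenIn K (λ y → ∀ i i∈is → D i i∈is y)
  dense-⋂ []       D dense = dense-U (λ _ _ ())
  dense-⋂ (i ∷ is) D dense w n Kw
    with dense-∩ (dense i (here refl))
                 (dense-⋂ is (λ j → D j ∘ there) (λ j → dense j ∘ there)) w n Kw
  ... | w′ , n′ , Kw′ , w~w′ , D′ =
    w′ , n′ , Kw′ , w~w′ , λ where
      y Ky w′~y _ (here refl)  → proj₁ (D′ y Ky w′~y)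
      y Ky w′~y j (there j∈is) → proj₂ (D′ y Ky w′~y) j j∈is

  dense-→ : ExcludedMiddle 0ℓ → ∀ {K D} {Q : Set} →
            (Q → DenseOpenIn K D) → DenseOpenIn K (λ y → Q → D y)
  dense-→ em {Q = Q} dense with em {Q}
  ... | no ¬q = dense-U (λ _ q → contradiction q ¬q)
  ... | yes q = λ w n Kw → let (w′ , n′ , Kw′ , w~w′ , D′) = dense q w n Kw
                           in w′ , n′ , Kw′ , w~w′ , λ y Ky w′~y _ → D′ y Ky w′~y

  module _ (K : Pred (ω-Word X) 0ℓ)
           (closed : ∀ y → (∀ n → ∃[ w ] K w × AgreeBelow n w y) → K y)
           (D : ℕ → Pred (ω-Word X) 0ℓ) (dense : ∀ j → DenseOpenIn K (D j))
           where

    private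
      approx : ∃ K → ℕ → ∃ K × ℕ
      approx w₀ ℕ.zero    = w₀ , 0
      approx w₀ (ℕ.suc j) =
        let ((w , Kw) , n)         = approx w₀ j
            (w′ , n′ , Kw′ , _ , _) = dense j w n Kw
        -- `ℕ.suc n` makes the depths strictly increase, so that the words converge.
        in (w′ , Kw′) , n′ ⊔ ℕ.suc n

    -- Baire's theorem in the closed subspace `K`: stage `j` moves to a word of `K` with a cylinder
    -- whose part in `K` lies in `D j`. The limit `y` is in all these cylinders, and in `K` by
    -- closedness.
    baire : ∃ K → ∃[ y ] K y × (∀ j → D j y)
    baire w₀ = y , Ky , Dy
      where
      word : ℕ → ω-Word X
      word j = proj₁ (proj₁ (approx w₀ j))

      depth : ℕ → ℕ
      depth j = proj₂ (approx w₀ j)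

      depth-suc : ∀ j → depth j ≤ depth (ℕ.suc j)
      depth-suc j = ≤-trans (n≤1+n _) (m≤n⊔m _ _)

      j≤depth : ∀ j → j ≤ depth j
      j≤depth ℕ.zero    = ℕ.z≤n
      j≤depth (ℕ.suc j) = ≤-trans (ℕ.s≤s (j≤depth j)) (m≤n⊔m _ _)

      agree-suc : ∀ j → AgreeBelow (depth j) (word j) (word (ℕ.suc j))
      agree-suc j =
        let ((w , Kw) , n) = approx w₀ j
            (_ , _ , _ , w~w′ , _) = dense j w n Kw
        in w~w′

      agree-later : ∀ j d → AgreeBelow (depth j) (word j) (word (d + j))
      depth-later : ∀ j d → depth j ≤ depth (d + j)
      depth-later j ℕ.zero    = ≤-refl
      depth-later j (ℕ.suc d) = ≤-trans (depth-later j d) (depth-suc (d + j))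
      agree-later j ℕ.zero    = agree-refl
      agree-later j (ℕ.suc d) =
        agree-trans (agree-later j d) (agree-≤ (depth-later j d) (agree-suc (d + j)))

      agree-word : ∀ {i j} → i ≤ j → AgreeBelow (depth i) (word i) (word j)
      agree-word {i} {j} i≤j =
        subst (AgreeBelow (depth i) (word i) ∘ word) (m∸n+n≡m i≤j) (agree-later i (j ∸ i))

      -- Letter `i` is final from stage `ℕ.suc i` on, whose depth exceeds `i`.
      y : ω-Word X
      y i = word (ℕ.suc i) i

      word~y : ∀ j → AgreeBelow (depth j) (word j) y
      word~y j i i<depth with ≤-total j (ℕ.suc i)
      ... | inj₁ j≤1+i = agree-word j≤1+i i i<depth
      ... | inj₂ 1+i≤j = sym (agree-word 1+i≤j i (j≤depth (ℕ.suc i)))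

      Ky : K y
      Ky = closed y λ n →
        word n , proj₂ (proj₁ (approx w₀ n)) , agree-≤ (j≤depth n) (word~y n)

      Dy : ∀ j → D j y
      Dy j =
        let ((w , Kw) , n) = approx w₀ j
            (_ , _ , _ , _ , D′) = dense j w n Kw
        in D′ y Ky (agree-≤ (m≤m⊔n _ _) (word~y (ℕ.suc j)))

uniform-bound : ∀ {s} (P : Fin s → ℕ → Set) → (∀ r {m n} → m ≤ n → P r m → P r n) →
                (∀ r → ∃ (P r)) → ∃[ n ] (∀ r → P r n)
uniform-bound {ℕ.zero}  P mono bound = 0 , λ ()
uniform-bound {ℕ.suc s} P mono bound
  with bound Fin.zero | uniform-bound (P ∘ Fin.suc) (mono ∘ Fin.suc) (bound ∘ Fin.suc)
... | m , Pm | n , Pn = m ⊔ n , λ where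
  Fin.zero    → mono Fin.zero (m≤m⊔n m n) Pm
  (Fin.suc r) → mono (Fin.suc r) (m≤n⊔m m n) (Pn r)

-- Limit sets of runs

module _ {X : Set} (N : Automaton X) where
  open Automaton N

  run-cong : ∀ q {x y} n → AgreeBelow n x y → run q x n ≡ run q y n
  run-cong q ℕ.zero    x~y = refl
  run-cong q (ℕ.suc n) x~y =
    cong₂ step (run-cong q n (agree-≤ (n≤1+n n) x~y)) (x~y n ≤-refl)

  run-splice : ∀ q w l x n → run q w l ≡ run q x n →
               ∀ j → run q (splice w l x n) (l + j) ≡ run q x (n + j)
  run-splice q w l x n w≡x ℕ.zero
    rewrite +-identityʳ l | +-identityʳ n =
    trans (sym (run-cong q l (splice-agree w l x n))) w≡x
  run-splice q w l x n w≡x (ℕ.suc j)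
    rewrite +-suc l j | +-suc n j =
    cong₂ step (run-splice q w l x n w≡x j) (splice-tail w l x n j)

  run-splice-≥ : ∀ q w l x n → run q w l ≡ run q x n → ∀ m → l ≤ m →
                 run q (splice w l x n) m ≡ run q x (n + (m ∸ l))
  run-splice-≥ q w l x n w≡x m l≤m =
    subst (λ i → run q (splice w l x n) i ≡ run q x (n + (m ∸ l)))
          (m+[n∸m]≡n l≤m) (run-splice q w l x n w≡x (m ∸ l))

  module _ (em : ExcludedMiddle 0ℓ) (q : State) where

    eventually-recurrent : ∀ x → ∃[ n ] (∀ m → n ≤ m → InfinitelyOften q x (run q x m))
    eventually-recurrent x =
      map₂ (λ bound m n≤m → bound _ m n≤m refl)
        (uniform-bound (λ r n → ∀ m → n ≤ m → run q x m ≡ r → InfinitelyOften q x r)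
          (λ r m≤n P k n≤k → P k (≤-trans m≤n n≤k))
          -- If `r` has no threshold it is visited after every time `m`, since otherwise `m` would
          -- be a vacuous threshold. Then `r` is recurrent and 0 is a threshold.
          λ r → decidable-stable em λ ¬bound →
            ¬bound (0 , λ _ _ _ m → decidable-stable em λ ¬visit →
              ¬bound (m , λ n m≤n eq → ⊥-elim (¬visit (n , m≤n , eq)))))

    recurrent-time : ∀ x n → ∃[ m ] n ≤ m × InfinitelyOften q x (run q x m)
    recurrent-time x n with eventually-recurrent x
    ... | l , rec = n ⊔ l , m≤m⊔n n l , rec _ (m≤n⊔m n l)

module _ {X : Set} where

  SameLimit : (N : Automaton X) → Automaton.State N → Rel (ω-Word X) 0ℓ
  SameLimit N q x y = InfinitelyOften q x ≐ InfinitelyOften q y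
    where open Automaton N

  module _ (em : ExcludedMiddle 0ℓ) (N M : Automaton X) where
    private
      module N = Automaton N
      module M = Automaton M

    module _ (f : N.State → M.State)
             (f-step : ∀ s a → f (N.step s a) ≡ M.step (f s) a) where

      run-hom : ∀ q x n → f (N.run q x n) ≡ M.run (f q) x n
      run-hom q x ℕ.zero    = refl
      run-hom q x (ℕ.suc n) =
        trans (f-step _ _) (cong (λ s → M.step s (x n)) (run-hom q x n))

      -- A state of `M` recurrent on `x` is the image of a state of `N` recurrent on `x`: look at a
      -- visit so late that `N` is only in recurrent states.
      limit-hom : ∀ {q x y} → N.InfinitelyOften q x ⊆ N.InfinitelyOften q y →
                  M.InfinitelyOften (f q) x ⊆ M.InfinitelyOften (f q) y
      limit-hom {q} {x} {y} x⊆y {r} x∞r m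
        with eventually-recurrent N em q x
      ... | l , rec with x∞r l
      ... | n , l≤n , refl with x⊆y (rec n l≤n) m
      ... | n′ , m≤n′ , eq = n′ , m≤n′ ,
        trans (sym (run-hom q y n′)) (trans (cong f eq) (run-hom q x n))

      sameLimit-hom : ∀ {q x y} → SameLimit N q x y → SameLimit M (f q) x y
      sameLimit-hom (x⊆y , y⊆x) = limit-hom x⊆y , limit-hom y⊆x

  -- Automata of a class and their products

  InClass : LanguageClass → Automaton X → Set
  InClass 𝓡 N = ⊤
  InClass 𝓐 N = Automaton.IsAperiodic N

  trivial : Automaton X
  trivial = record { size = 1 ; step = λ s _ → s }

  trivial-inClass : ∀ 𝓑 → InClass 𝓑 trivial
  trivial-inClass 𝓡 = tt
  trivial-inClass 𝓐 q u n _ _ _ = unique _ _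
    where
    unique : (r s : Fin 1) → r ≡ s
    unique Fin.zero Fin.zero = refl

  module _ (N M : Automaton X) where
    private
      module N = Automaton N
      module M = Automaton M

      π : Fin (N.size ℕ.* M.size) → N.State × M.State
      π = remQuot M.size

    product : Automaton X
    product = record
      { size = N.size ℕ.* M.size
      ; step = λ s a → combine (N.step (proj₁ (π s)) a) (M.step (proj₂ (π s)) a)
      }

    private
      module P = Automaton product

      π-step : ∀ s a → π (P.step s a) ≡ (N.step (proj₁ (π s)) a , M.step (proj₂ (π s)) a)
      π-step s a = remQuot-combine _ _

      π-step* : ∀ s u → π (P.step* s u) ≡ (N.step* (proj₁ (π s)) u , M.step* (proj₂ (π s)) u)
      π-step* s []      = refl
      π-step* s (a ∷ u) = trans (π-step* (P.step s a) u)
        (cong (λ p → N.step* (proj₁ p) u , M.step* (proj₂ p) u) (π-step s a))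

      π-injective : ∀ {s t} → π s ≡ π t → s ≡ t
      π-injective {s} {t} eq = trans (sym (combine-remQuot {N.size} M.size s))
        (trans (cong (λ p → combine (proj₁ p) (proj₂ p)) eq)
               (combine-remQuot {N.size} M.size t))

    -- In the aperiodic case a loop on a power of `u` projects to such loops in both factors, each
    -- of which fixes its state under `u`.
    product-inClass : ∀ 𝓑 → InClass 𝓑 N → InClass 𝓑 M → InClass 𝓑 product
    product-inClass 𝓡 _ _ = tt
    product-inClass 𝓐 aperN aperM q u n u≢[] 0<n loop = π-injective
      (trans (π-step* q u) (cong₂ _,_
        (aperN _ u n u≢[] 0<n (cong proj₁ π-loop))
        (aperM _ u n u≢[] 0<n (cong proj₂ π-loop))))
      where
      π-loop : _ ≡ π q
      π-loop = trans (sym (π-step* q (concat (replicate n u)))) (cong π loop)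

    sameLimit-product : ExcludedMiddle 0ℓ → ∀ {p q x y} →
      SameLimit product (combine p q) x y → SameLimit N p x y × SameLimit M q x y
    sameLimit-product em {p} {q} {x} {y} x∼y =
      subst (λ s → SameLimit N s x y) (cong proj₁ (remQuot-combine p q))
        (sameLimit-hom em product N (proj₁ ∘ π) (λ s a → cong proj₁ (π-step s a))
          {combine p q} {x} {y} x∼y) ,
      subst (λ s → SameLimit M s x y) (cong proj₂ (remQuot-combine p q))
        (sameLimit-hom em product M (proj₂ ∘ π) (λ s a → cong proj₂ (π-step s a))
          {combine p q} {x} {y} x∼y)

  -- For `Preserves L` this amounts to `L` belonging to the class. Relations, unlike single
  -- languages, let one automaton serve all sets of a family and a partition as well.
  Definable : LanguageClass → Rel (ω-Word X) 0ℓ → Set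
  Definable 𝓑 R = Σ[ N ∈ Automaton X ] Σ[ q ∈ Automaton.State N ]
                  InClass 𝓑 N × SameLimit N q ⇒ R

  Preserves : Pred (ω-Word X) 0ℓ → Rel (ω-Word X) 0ℓ
  Preserves L x y = L x → L y

-- Membership in a class as definability

allSubsets : ∀ n → List (Subset n)
allSubsets ℕ.zero    = [] ∷ []
allSubsets (ℕ.suc n) = cartesianProductWith _∷_ (true ∷ false ∷ []) (allSubsets n)

∈-allSubsets : ∀ {n} (p : Subset n) → p ∈ allSubsets n
∈-allSubsets []          = here refl
∈-allSubsets (true ∷ p) =
  ∈-cartesianProductWith⁺ _∷_ {true ∷ false ∷ []} (here refl) (∈-allSubsets p)
∈-allSubsets (false ∷ p) =
  ∈-cartesianProductWith⁺ _∷_ {true ∷ false ∷ []} (there (here refl)) (∈-allSubsets p)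

module _ (em : ExcludedMiddle 0ℓ) where

  toSubset : ∀ {n} → Pred (Fin n) 0ℓ → Subset n
  toSubset P = tabulate (λ r → does (em {P r}))

  toSubset-≐ : ∀ {n} (P : Pred (Fin n) 0ℓ) → P ≐ (Subset._∈ toSubset P)
  toSubset-≐ P =
    (λ {r} Pr → lookup⇒[]= r _ (trans (lookup∘tabulate _ r) (dec-true em Pr))) ,
    (λ {r} r∈ → does⇒ em (trans (sym (lookup∘tabulate _ r)) ([]=⇒lookup r∈)))
    where
    does⇒ : ∀ {Q : Set} (Q? : Dec Q) → does Q? ≡ true → Q
    does⇒ (yes Qr) _ = Qr

  module _ {X : Set} where

    definable-⊤ : ∀ 𝓑 {R : Rel (ω-Word X) 0ℓ} → (∀ {x y} → R x y) → Definable 𝓑 R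
    definable-⊤ 𝓑 R = trivial , Fin.zero , trivial-inClass 𝓑 , λ _ → R

    definable-⇒ : ∀ 𝓑 {R S : Rel (ω-Word X) 0ℓ} → R ⇒ S → Definable 𝓑 R → Definable 𝓑 S
    definable-⇒ 𝓑 R⇒S (N , q , inB , ∼⇒R) = N , q , inB , R⇒S ∘ ∼⇒R

    definable-sym : ∀ 𝓑 {R : Rel (ω-Word X) 0ℓ} → Definable 𝓑 R →
                    Definable 𝓑 (λ x y → R x y × R y x)
    definable-sym 𝓑 (N , q , inB , ∼⇒R) =
      N , q , inB , λ x∼y → ∼⇒R x∼y , ∼⇒R (swap x∼y)

    definable-∩ : ∀ 𝓑 {R S : Rel (ω-Word X) 0ℓ} → Definable 𝓑 R → Definable 𝓑 S →
                  Definable 𝓑 (λ x y → R x y × S x y)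
    definable-∩ 𝓑 (N , p , N∈𝓑 , N⇒R) (M , q , M∈𝓑 , M⇒S) =
      product N M , combine p q , product-inClass N M 𝓑 N∈𝓑 M∈𝓑 ,
      map N⇒R M⇒S ∘ sameLimit-product N M em

    definable-⋂ : ∀ 𝓑 {I : Set} (is : List I) {R : I → Rel (ω-Word X) 0ℓ} →
                  (∀ i → i ∈ is → Definable 𝓑 (R i)) →
                  Definable 𝓑 (λ x y → ∀ i → i ∈ is → R i x y)
    definable-⋂ 𝓑 []       defR = definable-⊤ 𝓑 λ _ ()
    definable-⋂ 𝓑 (i ∷ is) defR = definable-⇒ 𝓑
      (λ where (r , _)  _ (here refl) → r
               (_ , rs) j (there j∈is) → rs j j∈is)
      (definable-∩ 𝓑 (defR i (here refl)) (definable-⋂ 𝓑 is (λ j → defR j ∘ there)))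

    language-preserved : (M : MullerAcceptor X) → let open MullerAcceptor M in
                         {L : Pred (ω-Word X) 0ℓ} → L ≐ Language →
                         SameLimit automaton initial ⇒ Preserves L
    language-preserved M (L⊆ , ⊆L) x∼y Lx with L⊆ Lx
    ... | P , P∈acc , x≐P = ⊆L (P , P∈acc , ≐-trans (≐-sym x∼y) x≐P)

    member⇒definable : ∀ 𝓑 {L} → ⟦ 𝓑 ⟧ X L → Definable 𝓑 (Preserves L)
    member⇒definable 𝓡 (lift (M , L≐)) =
      MullerAcceptor.automaton M , MullerAcceptor.initial M , tt , language-preserved M L≐
    member⇒definable 𝓐 (lift (M , aper , L≐)) =
      MullerAcceptor.automaton M , MullerAcceptor.initial M , aper , language-preserved M L≐

    module _ (N : Automaton X) (q : Automaton.State N) (L : Pred (ω-Word X) 0ℓ) where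
      open Automaton N

      private
        IsLimitIn : Pred (Subset size) 0ℓ
        IsLimitIn P = ∃[ x ] L x × InfinitelyOften q x ≐ (Subset._∈ P)

      acceptor : MullerAcceptor X
      acceptor = record
        { automaton = N
        ; initial   = q
        ; accepting = filter (λ P → em {IsLimitIn P}) (allSubsets size)
        }

      -- The accepting sets are the limit sets of words of `L`. An accepted word thus shares its
      -- limit set with a word of `L`, and `pres` transfers membership.
      acceptor-language : SameLimit N q ⇒ Preserves L → L ≐ MullerAcceptor.Language acceptor
      acceptor-language pres =
        (λ {x} Lx → let x≐P = toSubset-≐ (InfinitelyOften q x) in
           _ , ∈-filter⁺ (λ P → em) (∈-allSubsets _) (x , Lx , x≐P) , x≐P) ,
        λ {y} (P , P∈acc , y≐P) →
          let (_ , x , Lx , x≐P) =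
                ∈-filter⁻ (λ P → em {IsLimitIn P}) {xs = allSubsets size} P∈acc
          in pres {x} {y} (≐-trans x≐P (≐-sym y≐P)) Lx

    definable⇒member : ∀ 𝓑 {L} → Definable 𝓑 (Preserves L) → ⟦ 𝓑 ⟧ X L
    definable⇒member 𝓡 (N , q , _ , pres) =
      lift (acceptor N q _ , acceptor-language N q _ pres)
    definable⇒member 𝓐 (N , q , aper , pres) =
      lift (acceptor N q _ , aper , acceptor-language N q _ pres)

-- Cylinders and loops contained in a set

module _ {X : Set} (N : Automaton X) (q : Automaton.State N) where
  open Automaton N

  -- As a predicate, `AgreeBelow n w` is the cylinder of the prefix of `w` of length `n`.
  CylinderIn : Pred (ω-Word X) 0ℓ → Pred State 0ℓ
  CylinderIn L r = ∃[ w ] ∃[ n ] run q w n ≡ r × AgreeBelow n w ⊆ L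

  Reaches : Pred (ω-Word X) 0ℓ → Pred (ω-Word X) 0ℓ
  Reaches L x = ∃[ n ] CylinderIn L (run q x n)

  StaysIn : Pred State 0ℓ → ω-Word X → ℕ → Pred (ω-Word X) 0ℓ
  StaysIn P w n y = AgreeBelow n w y × (∀ m → n ≤ m → P (run q y m))

  LoopIn : Pred (ω-Word X) 0ℓ → Pred State 0ℓ → Set
  LoopIn L P = ∃[ w ] ∃[ n ] P (run q w n) × StaysIn P w n ⊆ L

  -- Appending the segment of `x` between `m` and `n` to the prefix of `w` shrinks the cylinder and
  -- moves its end state along the run of `x`.
  cylinder-later : ∀ {L x m n} → m ≤ n → CylinderIn L (run q x m) → CylinderIn L (run q x n)
  cylinder-later {L} {x} {m} {n} m≤n (w , l , w≡x , cyl) =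
    splice w l x m , l + (n ∸ m) ,
    trans (run-splice N q w l x m w≡x (n ∸ m)) (cong (run q x) (m+[n∸m]≡n m≤n)) ,
    λ s~y → cyl (agree-trans (splice-agree w l x m) (agree-≤ (m≤m+n l _) s~y))

  reaches-mono : ∀ {L L′} → L ⊆ L′ → Reaches L ⊆ Reaches L′
  reaches-mono L⊆L′ (n , w , l , w≡x , cyl) = n , w , l , w≡x , L⊆L′ ∘ cyl

  reaches-open : ∀ {L} → IsOpen (Reaches L)
  reaches-open {L} x (n , cyl) = n , λ y x~y → n , subst (CylinderIn L) (run-cong N q n x~y) cyl

  open⊆reaches : ∀ {L} → IsOpen L → L ⊆ Reaches L
  open⊆reaches open-L {x} Lx with open-L x Lx
  ... | n , cyl = n , x , n , refl , λ {y} → cyl y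

  loop-mono : ∀ {L L′ P} → L ⊆ L′ → LoopIn L P → LoopIn L′ P
  loop-mono L⊆L′ (w , n , Pw , stays) = w , n , Pw , L⊆L′ ∘ stays

  stays-mono : ∀ {P P′ w n} → P ⊆ P′ → StaysIn P w n ⊆ StaysIn P′ w n
  stays-mono P⊆P′ (w~y , stays) = w~y , λ m n≤m → P⊆P′ (stays m n≤m)

  -- Up to time `m` the run of `y` is that of `z`, which is in `P` from `n` on; after `m` it is in
  -- `P` by its own condition.
  stays-extend : ∀ {P w n z m} → StaysIn P w n z → n ≤ m → StaysIn P z m ⊆ StaysIn P w n
  stays-extend {P} {z = z} {m} (w~z , z-stays) n≤m {y} (z~y , y-stays) =
    agree-trans w~z (agree-≤ n≤m z~y) , λ k n≤k → stays k n≤k (≤-total k m)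
    where
    stays : ∀ k → _ ≤ k → _ → P (run q y k)
    stays k n≤k (inj₁ k≤m) = subst P (run-cong N q k (agree-≤ k≤m z~y)) (z-stays k n≤k)
    stays k n≤k (inj₂ m≤k) = y-stays k m≤k

  module _ (em : ExcludedMiddle 0ℓ) where

    -- Each single condition in `StaysIn` depends on a finite prefix only.
    stays-closed : ∀ {P w n} y → (∀ l → ∃[ z ] StaysIn P w n z × AgreeBelow l z y) →
                   StaysIn P w n y
    stays-closed {P} {w} {n} y approx =
      (let (_ , (w~z , _) , z~y) = approx n in agree-trans w~z z~y) ,
      λ m n≤m → let (_ , (_ , stays) , z~y) = approx m
                in subst P (run-cong N q m z~y) (stays m n≤m)

    -- The state of `x` with a cylinder may be moved to a recurrent one, and `y` visits that state
    -- too.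
    reaches-limit : ∀ {L} → SameLimit N q ⇒ Preserves (Reaches L)
    reaches-limit {L} {x} {y} (x⊆y , _) (n , cyl) with recurrent-time N em q x n
    ... | m , n≤m , rec with x⊆y rec 0
    ... | k , _ , y≡x = k , subst (CylinderIn L) (sym y≡x) (cylinder-later n≤m cyl)

    module _ (x : ω-Word X) where
      private
        P : Pred State 0ℓ
        P = InfinitelyOften q x

      -- The limit set of `x` is strongly connected inside itself: a word that has entered it can
      -- continue as `x` does, never leaving it.
      follow : ∀ w n → P (run q w n) →
               ∃[ z ] ∃[ a ] StaysIn P w n z × (∀ k → run q z (n + k) ≡ run q x (a + k))
      follow w n Pw with eventually-recurrent N em q x
      -- The visit is taken after `l`, so that the grafted tail meets only recurrent states.
      ... | l , rec with Pw l
      ... | a , l≤a , x≡w =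
        splice w n x a , a ,
        (splice-agree w n x a , λ m n≤m →
          subst P (sym (run-splice-≥ N q w n x a (sym x≡w) m n≤m))
                  (rec _ (≤-trans l≤a (m≤m+n a _)))) ,
        run-splice N q w n x a (sym x≡w)

      -- A loop of N inside a larger one is reachable from it without leaving it.
      loop-shrink : ∀ {L} y → InfinitelyOften q y ⊆ P → LoopIn L P →
                    LoopIn L (InfinitelyOften q y)
      loop-shrink y y⊆x (w , n , Pw , stays) with follow w n Pw | recurrent-time N em q y 0
      ... | z , a , z-stays , z≡x | b , _ , rec with y⊆x rec a
      ... | c , a≤c , x≡y =
        z , n + (c ∸ a) ,
        subst (InfinitelyOften q y)
          (sym (trans (z≡x (c ∸ a)) (trans (cong (run q x) (m+[n∸m]≡n a≤c)) x≡y))) rec ,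
        stays ∘ stays-extend {P} {w} {n} z-stays (m≤m+n n _) ∘ stays-mono {P′ = P} y⊆x

      -- Generic words among those whose run stays in the limit set of `x`

      module _ (w : ω-Word X) (n : ℕ) (Pw : P (run q w n)) where
        private
          K : Pred (ω-Word X) 0ℓ
          K = StaysIn P w n

        dense-visit : ∀ r j → P r → DenseOpenIn K (λ y → ∃[ m ] j ≤ m × run q y m ≡ r)
        dense-visit r j Pr w′ n′ Kw′
          with follow w′ (n ⊔ n′) (proj₂ Kw′ (n ⊔ n′) (m≤m⊔n n n′))
        -- A visit of `x` after `a + j` becomes a visit of `z` after `j`, as `z` follows `x` from
        -- position `a`.
        ... | z , a , z-stays , z≡x with Pr (a + j)
        ... | b , a+j≤b , x≡r =
          z , t , stays-extend {P} {w} {n} Kw′ (m≤m⊔n n n′) z-stays ,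
          agree-≤ (m≤n⊔m n n′) (proj₁ z-stays) ,
          λ y _ z~y → t , ≤-trans j≤b∸a (m≤n+m (b ∸ a) (n ⊔ n′)) ,
            trans (sym (run-cong N q t z~y))
              (trans (z≡x (b ∸ a)) (trans (cong (run q x) (m+[n∸m]≡n a≤b)) x≡r))
          where
          t : ℕ
          t = n ⊔ n′ + (b ∸ a)
          a≤b : a ≤ b
          a≤b = ≤-trans (m≤m+n a j) a+j≤b
          j≤b∸a : j ≤ b ∸ a
          j≤b∸a = subst (_≤ b ∸ a) (m+n∸m≡n a j) (∸-monoˡ-≤ a a+j≤b)

        -- Without a loop in `L`, every basic piece of `K` contains a word `z` outside `L`, hence
        -- outside `C`. As `C` is closed, it misses a whole cylinder around `z`.
        dense-avoid : ∀ {L C} → IsClosed C → (K ∩ C) ⊆ L → ¬ LoopIn L P →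
                      DenseOpenIn K (λ y → ¬ C y)
        dense-avoid {L} {C} closed K∩C⊆L ¬loop w′ n′ Kw′
          with decidable-stable (em {∃[ z ] StaysIn P w′ (n ⊔ n′) z × ¬ L z})
                 (λ ∄z → ¬loop (w′ , n ⊔ n′ , proj₂ Kw′ _ (m≤m⊔n n n′) ,
                   λ {z} z-stays → decidable-stable em λ ¬Lz → ∄z (z , z-stays , ¬Lz)))
        ... | z , z-stays , ¬Lz = z , proj₁ z∉C , Kz , agree-≤ (m≤n⊔m n n′) (proj₁ z-stays) ,
                                  λ y _ → proj₂ z∉C y
          where
          Kz : K z
          Kz = stays-extend {P} {w} {n} Kw′ (m≤m⊔n n n′) z-stays
          z∉C : ∃[ l ] (∀ y → AgreeBelow l z y → ¬ C y)
          z∉C = closed z (λ Cz → ¬Lz (K∩C⊆L (Kz , Cz)))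

        -- Membership in `K` bounds the limit set of `y` above by `P`, and the dense sets `Visits j`
        -- bound it below. The sets `Avoids j` take `y` out of every closed piece of each `C i` for
        -- which `P` has no loop in `L i`.
        generic : ∀ {I : Set} (is : List I) (L : I → Pred (ω-Word X) 0ℓ)
                  (C : ∀ i → i ∈ is → ℕ → Pred (ω-Word X) 0ℓ) →
                  (∀ i i∈is j → IsClosed (C i i∈is j)) →
                  (∀ i i∈is j → (K ∩ C i i∈is j) ⊆ L i) →
                  ∃[ y ] K y × SameLimit N q x y ×
                         (∀ i i∈is → ¬ LoopIn (L i) P → ¬ ⋃ ℕ (C i i∈is) y)
        generic is L C closed K∩C⊆L =
          let (z , _ , Kz , _) = follow w n Pw
              (y , Ky , D) =
                baire K (stays-closed {P} {w} {n}) (λ j → Visits j ∩ Avoids j)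
                  (λ j → dense-∩ {K = K} {Visits j} {Avoids j}
                    (dense-visits j) (dense-avoids j))
                  (z , Kz)
          in y , Ky ,
             ((λ Pr j → proj₁ (D j) _ (∈-allFin _) Pr) ,
              (λ y∞r → let (m , n≤m , y≡r) = y∞r n in subst P y≡r (proj₂ Ky m n≤m))) ,
             λ i i∈is ¬loop (j , Cy) → proj₂ (D j) i i∈is ¬loop Cy
          where
          VisitsIf : ℕ → State → Pred (ω-Word X) 0ℓ
          VisitsIf j r y = P r → ∃[ m ] j ≤ m × run q y m ≡ r

          AvoidsIf : ℕ → ∀ i → i ∈ is → Pred (ω-Word X) 0ℓ
          AvoidsIf j i i∈is y = ¬ LoopIn (L i) P → ¬ C i i∈is j y

          Visits Avoids : ℕ → Pred (ω-Word X) 0ℓ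
          Visits j y = ∀ r → r ∈ allFin size → VisitsIf j r y
          Avoids j y = ∀ i i∈is → AvoidsIf j i i∈is y

          dense-visits : ∀ j → DenseOpenIn K (Visits j)
          dense-visits j = dense-⋂ {K = K} (allFin size) (λ r _ → VisitsIf j r) λ r _ →
            dense-→ em {K} {λ y → ∃[ m ] j ≤ m × run q y m ≡ r} {P r} (dense-visit r j)

          dense-avoids : ∀ j → DenseOpenIn K (Avoids j)
          dense-avoids j = dense-⋂ {K = K} is (AvoidsIf j) λ i i∈is →
            dense-→ em {K} {λ y → ¬ C i i∈is j y} {¬ LoopIn (L i) P}
              (dense-avoid {L i} {C i i∈is j} (closed i i∈is j) (K∩C⊆L i i∈is j))

    loop-limit : ∀ {L} → SameLimit N q ⇒ Preserves (LoopIn L ∘ InfinitelyOften q)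
    loop-limit {x = x} {y} (_ , y⊆x) = loop-shrink x y y⊆x

    -- By `loop-shrink` it is enough that the run eventually stays in the limit set of some `z` with
    -- a loop in `L`. Fixing the time `n` from which it stays gives the closed set `C n`.
    loop-Σ⁰₂ : ∀ L → Σ⁰₂ X (LoopIn L ∘ InfinitelyOften q)
    loop-Σ⁰₂ L = C , closed ,
      (λ {x} loop → let (n , rec) = eventually-recurrent N em q x in n , x , loop , rec) ,
      (λ {x} (n , z , loop , stays) → loop-shrink z x
        (λ x∞r → let (m , n≤m , x≡r) = x∞r n
                 in subst (InfinitelyOften q z) x≡r (stays m n≤m)) loop)
      where
      C : ℕ → Pred (ω-Word X) 0ℓ
      C n x = ∃[ z ] LoopIn L (InfinitelyOften q z) ×
                     (∀ m → n ≤ m → InfinitelyOften q z (run q x m))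

      closed : ∀ n → IsClosed (C n)
      -- Every state that `x` visits from `n` on already occurs between `n` and `l`. If `y` agrees
      -- with `x` up to `l` and lies in `C n` through `z`, then so does `x`.
      closed n x x∉C = l , λ y x~y (z , loop , stays) →
        x∉C (z , loop , λ m n≤m →
          let (m′ , n≤m′ , m′<l , x≡) = seen (run q x m) (m , n≤m , refl)
          in subst (InfinitelyOften q z)
               (trans (sym (run-cong N q m′ (agree-≤ (<⇒≤ m′<l) x~y))) x≡) (stays m′ n≤m′))
        where
        Seen : State → ℕ → Set
        Seen r l = (∃[ m ] n ≤ m × run q x m ≡ r) → ∃[ m ] n ≤ m × m < l × run q x m ≡ r

        bound : ∃[ l ] (∀ r → Seen r l)
        bound = uniform-bound Seen
          (λ r l≤l′ s visit → map₂ (map₂ (map₁ (λ m<l → <-≤-trans m<l l≤l′))) (s visit))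
          λ r → decidable-stable em λ ∄l →
            ∄l (0 , λ (m , n≤m , x≡r) → ⊥-elim (∄l (ℕ.suc m , λ _ → m , n≤m , ≤-refl , x≡r)))

        l : ℕ
        l = proj₁ bound
        seen : ∀ r → Seen r l
        seen = proj₂ bound

-- Residues

module _ {S : Set} (em : ExcludedMiddle 0ℓ) (W : List String) (V : String → Pred S 0ℓ) where

  -- Moving to a successor whose set contains `x` must stop, since the lengths of nodes are bounded.
  -- The counter `d` keeps `bound < length τ + d` true.
  in-some-residue : ∀ {x τ} → τ ∈ W → V τ x → ∃[ τ′ ] τ′ ∈ W × residue W V τ′ x
  in-some-residue {x} {τ} τ∈W Vx = climb (ℕ.suc bound) τ τ∈W Vx (m≤n+m (ℕ.suc bound) (length τ))
    where
    bound : ℕ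
    bound = max 0 (List.map length W)

    length≤bound : ∀ {τ} → τ ∈ W → length τ ≤ bound
    length≤bound τ∈W = All.lookup (xs≤max 0 (List.map length W)) (∈-map⁺ length τ∈W)

    climb : ∀ d τ → τ ∈ W → V τ x → bound < length τ + d → ∃[ τ′ ] τ′ ∈ W × residue W V τ′ x
    climb ℕ.zero τ τ∈W Vx bound< =
      contradiction (length≤bound τ∈W) (<⇒≱ (subst (bound <_) (+-identityʳ _) bound<))
    climb (ℕ.suc d) τ τ∈W Vx bound< with em {∃[ i ] (τ ∷ʳ i) ∈ W × V (τ ∷ʳ i) x}
    ... | no  ∄i              = τ , τ∈W , Vx , ∄i
    ... | yes (i , τi∈W , Vi) = climb d (τ ∷ʳ i) τi∈W Vi
      (subst (bound <_)
        (trans (sym (+-assoc (length τ) 1 d)) (cong (_+ d) (sym (length-++ τ)))) bound<)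

residue-cong : ∀ {S : Set} {W : List String} (V : String → Pred S 0ℓ) {x y : S} →
               (∀ τ → τ ∈ W → V τ x → V τ y) → (∀ τ → τ ∈ W → V τ y → V τ x) →
               ∀ τ → τ ∈ W → residue W V τ x → residue W V τ y
residue-cong V x⇒y y⇒x τ τ∈W (Vx , ∄i) =
  x⇒y τ τ∈W Vx , λ (i , τi∈W , Vi) → ∄i (i , τi∈W , y⇒x _ τi∈W Vi)

-- Some set of the family contains the point, and the sets grow along the prefixes down to the root.
⊆-root : ∀ {S Label : Set} (T : Tree Label) {𝓛 S′} {V : String → Pred S 0ℓ} →
         IsFamily (Tree.nodes T) 𝓛 S′ V → S′ ⊆ V []
⊆-root T {V = V} family S′x with proj₂ (IsFamily.covers family) S′x
... | σ , σ∈T , Vx = descend [] σ σ∈T Vx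
  where
  open Tree T
  descend : ∀ ρ π → (ρ ++ π) ∈ nodes → V (ρ ++ π) ⊆ V ρ
  descend ρ []      ρ∈ Vx = subst (λ τ → V τ _) (++-identityʳ ρ) Vx
  descend ρ (i ∷ π) ρπ∈ {x} Vx =
    IsFamily.decreasing family ρ i (prefix-closed ρ (i ∷ π) ρπ∈)
      (prefix-closed (ρ ∷ʳ i) π ρiπ∈)
      (descend (ρ ∷ʳ i) π ρiπ∈ (subst (λ τ → V τ x) (sym (∷ʳ-++ ρ i π)) Vx))
    where
    ρiπ∈ : (ρ ∷ʳ i ++ π) ∈ nodes
    ρiπ∈ = subst (_∈ nodes) (sym (∷ʳ-++ ρ i π)) ρπ∈

-- Levels over the class and the two inclusions

module _ (em : ExcludedMiddle 0ℓ) {X : Set} {k : ℕ} (𝓑 : LanguageClass)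
         (F : Forest (Tree (Fin k))) where
  private
    module F = Forest F
    module V (τ : String) = Tree (F.label τ)

  partition-definable : {A : ω-Word X → Fin k} → Partitions k (⟦ 𝓑 ⟧ X) A →
                        Definable 𝓑 (λ x y → A x ≡ A y)
  partition-definable {A} A∈𝓑 = definable-⇒ em 𝓑
    (λ {x} pres → sym (pres (A x) (∈-allFin _) refl))
    (definable-⋂ em 𝓑 (allFin k) (λ i _ → member⇒definable em 𝓑 (A∈𝓑 i)))

  definable-partition : {A : ω-Word X → Fin k} → Definable 𝓑 (λ x y → A x ≡ A y) →
                        Partitions k (⟦ 𝓑 ⟧ X) A
  definable-partition defA i =
    definable⇒member em 𝓑 (definable-⇒ em 𝓑 (λ Ax≡Ay Ax≡i → trans (sym Ax≡Ay) Ax≡i) defA)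

  module _ (u : ForestFamily (𝓑 𝚺[ X ]) F) where
    open ForestFamily u

    outer-definable : Definable 𝓑 (λ x y → ∀ τ → τ ∈ F.nodes → outer τ x → outer τ y)
    outer-definable = definable-⋂ em 𝓑 F.nodes λ τ τ∈F →
      member⇒definable em 𝓑 (proj₁ (IsFamily.inBase outerFamily τ τ∈F))

    InnerPreserved : Rel (ω-Word X) 0ℓ
    InnerPreserved x y =
      ∀ τ → τ ∈ F.nodes → ∀ σ → σ ∈ V.nodes τ → inner τ σ x → inner τ σ y

    -- An inner set is an outer residue cut with a set of the class. A residue involves complements,
    -- so the outer sets must be preserved in both directions.
    inner-definable : Definable 𝓑 InnerPreserved
    inner-definable = definable-⋂ em 𝓑 F.nodes λ τ τ∈F → definable-⋂ em 𝓑 (V.nodes τ) λ σ σ∈V →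
      let (_ , (B∈𝓑 , _) , ⊆B , B⊆) = IsFamily.inBase (innerFamily τ τ∈F) σ σ∈V
      in definable-⇒ em 𝓑
           (λ ((x⇒y , y⇒x) , Bx⇒By) Ix → let (Rx , Bx) = ⊆B Ix in
             B⊆ (residue-cong outer x⇒y y⇒x τ τ∈F Rx , Bx⇒By Bx))
           (definable-∩ em 𝓑 (definable-sym em 𝓑 outer-definable) (member⇒definable em 𝓑 B∈𝓑))

    -- `x` lies in some residue at both stages; `y` lies in the same inner residue, so both values
    -- of `A` equal its label.
    determined-definable : ∀ {A} → Determines A → Definable 𝓑 (λ x y → A x ≡ A y)
    determined-definable {A} det = definable-⇒ em 𝓑 same (definable-sym em 𝓑 inner-definable)
      where
      same : ∀ {x y} → InnerPreserved x y × InnerPreserved y x → A x ≡ A y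
      same {x} {y} (x⇒y , y⇒x) with proj₂ (IsFamily.covers outerFamily) {x} tt
      ... | _ , τ₀∈F , Ox with in-some-residue em F.nodes outer τ₀∈F Ox
      ... | τ , τ∈F , Rx with proj₂ (IsFamily.covers (innerFamily τ τ∈F)) Rx
      ... | _ , σ₀∈V , Ix with in-some-residue em (V.nodes τ) (inner τ) σ₀∈V Ix
      ... | σ , σ∈V , R′x =
        trans (det τ σ τ∈F σ∈V x R′x) (sym (det τ σ τ∈F σ∈V y
          (residue-cong (inner τ) (x⇒y τ τ∈F) (y⇒x τ τ∈F) σ σ∈V R′x)))

  forget : ForestFamily (𝓑 𝚺[ X ]) F → ForestFamily (𝚺 X) F
  forget u = record
    { outer       = outer
    ; inner       = inner
    ; outerFamily = record
        { inBase     = λ τ τ∈F → proj₂ (Outer.inBase τ τ∈F)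
        ; decreasing = Outer.decreasing
        ; covers     = Outer.covers
        }
    ; innerFamily = λ τ τ∈F → let module Inner = IsFamily (innerFamily τ τ∈F) in record
        { inBase     = λ σ σ∈V → map₂ (map₁ proj₂) (Inner.inBase σ σ∈V)
        ; decreasing = Inner.decreasing
        ; covers     = Inner.covers
        }
    }
    where
    open ForestFamily u
    module Outer = IsFamily outerFamily

  -- Saturating a family under equality of limit sets

  module _ (u : ForestFamily (𝚺 X) F) (N : Automaton X) (q : Automaton.State N)
           (N∈𝓑 : InClass 𝓑 N) where
    open Automaton N
    open ForestFamily u
    private
      module Outer = IsFamily outerFamily
      module Inner {τ} (τ∈F : τ ∈ F.nodes) = IsFamily (innerFamily τ τ∈F)

      outer′ : String → Pred (ω-Word X) 0ℓ
      outer′ τ = Reaches N q (outer τ)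

      loop : String → String → Pred (ω-Word X) 0ℓ
      loop τ σ = LoopIn N q (inner τ σ) ∘ InfinitelyOften q

      inner′ : String → String → Pred (ω-Word X) 0ℓ
      inner′ τ σ = residue F.nodes outer′ τ ∩ loop τ σ

      recognised : ∀ {L} → SameLimit N q ⇒ Preserves L → ⟦ 𝓑 ⟧ X L
      recognised pres = definable⇒member em 𝓑 (N , q , N∈𝓑 , pres)

      -- Take a cylinder in `outer τ` ending in a recurrent state of `x`. A word `y` of it that
      -- stays in the limit set of `x` avoids each `outer (τ ∷ʳ i)`, for otherwise `x` would meet
      -- the end state of a cylinder in that set. So `y` is in the old residue, which the root set
      -- covers.
      residue⊆loop-root : ∀ {τ} → τ ∈ F.nodes → residue F.nodes outer′ τ ⊆ loop τ []
      residue⊆loop-root {τ} τ∈F {x} ((n , cyl) , ∄i) with recurrent-time N em q x n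
      ... | m , n≤m , rec with cylinder-later N q n≤m cyl
      ... | w , l , w≡x , cylinder =
        w , l , subst (InfinitelyOften q x) (sym w≡x) rec ,
        λ {y} (w~y , stays) → ⊆-root (F.label τ) (innerFamily τ τ∈F)
          (cylinder w~y , λ (i , τi∈F , Oy) →
            let (d , cyl′)    = lower (Outer.inBase _ τi∈F) y Oy
                (c , _ , x≡y) = stays (l ⊔ d) (m≤m⊔n l d) 0
            in ∄i (i , τi∈F , c , y , l ⊔ d , sym x≡y ,
                   λ {z} y~z → cyl′ z (agree-≤ (m≤n⊔m l d) y~z)))

    saturate : ForestFamily (𝓑 𝚺[ X ]) F
    saturate = record
      { outer       = outer′
      ; inner       = inner′
      ; outerFamily = record
          { inBase     = λ τ τ∈F → recognised (reaches-limit N q em) , lift (reaches-open N q)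
          ; decreasing = λ τ i τ∈F τi∈F →
              reaches-mono N q {outer (τ ∷ʳ i)} {outer τ} (Outer.decreasing τ i τ∈F τi∈F)
          ; covers     = (λ _ → tt) , λ Ux →
              let (τ , τ∈F , Ox) = proj₂ Outer.covers Ux
              in τ , τ∈F , open⊆reaches N q (lower (Outer.inBase τ τ∈F)) Ox
          }
      ; innerFamily = λ τ τ∈F → record
          { inBase     = λ σ σ∈V →
              loop τ σ ,
              (recognised (loop-limit N q em) , loop-Σ⁰₂ N q em (inner τ σ)) ,
              id , id
          ; decreasing = λ σ i σ∈V σi∈V {x} →
              map₂ (loop-mono N q {P = InfinitelyOften q x} (Inner.decreasing τ∈F σ i σ∈V σi∈V))
          ; covers     = (λ (_ , _ , Rx , _) → Rx) ,
              λ Rx → [] , V.root τ , Rx , residue⊆loop-root τ∈F Rx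
          }
      }

    -- The generic `y` is in `inner τ σ` because it stays in the loop. It is in no successor's set
    -- because `x`, being in the new residue, has no loop there.
    saturate-determines : ∀ {A} → (∀ {x y} → SameLimit N q x y → A x ≡ A y) →
                          Determines A → ForestFamily.Determines saturate A
    saturate-determines invariant det τ σ τ∈F σ∈V x ((Rx , w , n , Pw , stays) , ∄i) =
      let (y , Ky , x∼y , avoid) = generic N q em x w n Pw (V.nodes τ) (inner τ) C closed K∩C⊆
      in trans (invariant x∼y) (det τ σ τ∈F σ∈V y
           (stays Ky , λ (i , σi∈V , Iy) →
             avoid (σ ∷ʳ i) σi∈V (λ loop-σi → ∄i (i , σi∈V , Rx , loop-σi)) (⊆C _ σi∈V Iy)))
      where
      C : ∀ ρ → ρ ∈ V.nodes τ → ℕ → Pred (ω-Word X) 0ℓ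
      C ρ ρ∈V = let (_ , (C , _) , _) = Inner.inBase τ∈F ρ ρ∈V in C

      closed : ∀ ρ ρ∈V j → IsClosed (C ρ ρ∈V j)
      closed ρ ρ∈V = let (_ , (_ , closed , _) , _) = Inner.inBase τ∈F ρ ρ∈V in closed

      ⊆C : ∀ ρ ρ∈V → inner τ ρ ⊆ ⋃ ℕ (C ρ ρ∈V)
      ⊆C ρ ρ∈V Iy = let (_ , (_ , _ , B⊆C , _) , ⊆B , _) = Inner.inBase τ∈F ρ ρ∈V
                    in B⊆C (proj₂ (⊆B Iy))

      -- Words that stay in the loop are in `inner τ σ`, hence in the residue of `outer τ`, on which
      -- `inner τ ρ` coincides with its Σ⁰₂ set.
      K∩C⊆ : ∀ ρ ρ∈V j → (StaysIn N q (InfinitelyOften q x) w n ∩ C ρ ρ∈V j) ⊆ inner τ ρ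
      K∩C⊆ ρ ρ∈V j (Ky , Cy) =
        let (_ , (_ , _ , _ , C⊆B) , _ , B⊆) = Inner.inBase τ∈F ρ ρ∈V
        in B⊆ (proj₁ (Inner.covers τ∈F) (σ , σ∈V , stays Ky) , C⊆B (j , Cy))

theorem4p14 : ExcludedMiddle (suc 0ℓ) →
    (X : Set) (m : ℕ) → 2 ≤ m → X ↔ Fin m →
    (k : ℕ) → 2 ≤ k →
    (𝓑 : LanguageClass) (F : Forest (Tree (Fin k))) →
    levelOf (𝓑 𝚺[ X ]) F ≐ (Partitions k (⟦ 𝓑 ⟧ X) ∩ levelOf (𝚺 X) F)
theorem4p14 em₁ X _ _ _ k _ 𝓑 F =
  (λ (u , det) →
    definable-partition em 𝓑 F (determined-definable em 𝓑 F u det) ,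
    forget em 𝓑 F u , det) ,
  (λ (A∈𝓑 , u , det) →
    let (N , q , N∈𝓑 , invariant) = partition-definable em 𝓑 F A∈𝓑
    in saturate em 𝓑 F u N q N∈𝓑 , saturate-determines em 𝓑 F u N q N∈𝓑 invariant det)
  where
  em : ExcludedMiddle 0ℓ
  em = em-lower em₁
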